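{- Let $n$ be a positive integer. The game graph $G(n,n)$ of Nim started from two heaps each of size $n$ has order $\frac{1}{2}(n^2+3n+2)$, size $\frac{1}{2}n(n+1)^2$, and metric dimension $\lceil \frac{n}{2}\rceil$.
   Context: Two-heap Nim: a position is a multiset $\{a,b\}$ of two heap sizes $a,b\ge 0$ (unordered, possibly equal; empty heaps are recorded as $0$). A move removes any positive number of stones from exactly one heap, i.e. replaces one of the two heap sizes by a strictly smaller nonnegative integer. The game graph $G(n,n)$ is the digraph whose vertices are all positions reachable from $\{n,n\}$ (including $\{n,n\}$ itself), with an arc from a position $p$ to a position $q$ whenever there is a legal move from $p$ to $q$ (each position, as a multiset, appears as one vertex, and there is at most one arc from $p$ to $q$). The order of a graph is its number of vertices; its size is its number of arcs. Signed distance: in a digraph, let $d(u,v)$ be the number of arcs in a shortest directed path from $u$ to $v$ ($\infty$ if there is none, $d(u,u)=0$). The signed distance is $$d_{\pm}(u,v)=\begin{cases} d(u,v) & \text{if there is a directed } uv\text{ -path and } d(u,v)\le d(v,u),\\ -d(v,u) & \text{if there is a directed } vu\text{ -path and } d(v,u)<d(u,v),\\ \infty & \text{if there is neither a directed } uv\text{ -path nor a directed } vu\text{ -path.}\end{cases}$$ Metric dimension: for an ordered set $S=(u_1,\dots,u_k)$ of vertices, the distance vector of a vertex $v$ is $(d_\pm(u_1,v),\dots,d_\pm(u_k,v))$. $S$ is a resolving set if distinct vertices of the graph have distinct distance vectors. The metric dimension is the minimum cardinality of a resolving set. -}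

module Defs where

open import Data.Integer.Base as ℤ using (ℤ; +_)
open import Data.List.Base using (List; []; _∷_; length)
open import Data.List.Membership.Propositional using (_∈_; _∉_)
open import Data.List.Relation.Binary.Pointwise.Base using (Pointwise)
open import Data.List.Relation.Unary.Unique.Propositional using (Unique)
open import Data.Nat.Base using (ℕ; _≤_; _<_; _⊓_; _⊔_)
open import Data.Nat.Properties using (m⊓n≤m⊔n)
open import Data.Product.Base using (_×_; ∃-syntax; uncurry)
open import Data.Refinement.Base using (Refinement; Refinement-syntax; value)
open import Function.Bundles using (_⇔_)
open import Relation.Binary.Construct.Closure.ReflexiveTransitive using (Star)
open import Relation.Binary.PropositionalEquality.Core using (_≡_; _≢_)
open import Relation.Nullary.Construct.Add.Supremum using (_⁺; ⊤⁺; [_])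
open import Relation.Nullary.Negation.Core using (¬_)
open import Relation.Unary using (Pred; U)
open import Level using (0ℓ)

import Relation.Binary.Construct.Add.Supremum.NonStrict _≤_ as NonStrict
import Relation.Binary.Construct.Add.Supremum.Strict _<_ as Strict

open NonStrict using (_≤⁺_)
open Strict using (_<⁺_)

record Digraph : Set₁ where
  field
    Vertex : Set
    Arc    : Vertex → Vertex → Set

-- Counts the elements satisfying P, not the proofs that they do.
HasCardinality : {A : Set} → Pred A 0ℓ → ℕ → Set
HasCardinality P k =
  ∃[ xs ] Unique xs × (∀ x → x ∈ xs ⇔ P x) × length xs ≡ k

module _ (G : Digraph) where
  open Digraph G

  HasOrder : ℕ → Set
  HasOrder = HasCardinality {Vertex} U

  -- There is at most one arc from one vertex to another, so arcs are counted
  -- as ordered pairs of vertices, whatever the number of proofs of Arc.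
  HasSize : ℕ → Set
  HasSize = HasCardinality {Vertex × Vertex} (uncurry Arc)

  -- In Path u xs v the list xs holds the vertices after u, so that length xs
  -- is the number of arcs.  No vertex is repeated.
  data Path : Vertex → List Vertex → Vertex → Set where
    nil  : ∀ {u} → Path u [] u
    cons : ∀ {u w v xs} → Arc u w → u ∉ w ∷ xs → Path w xs v →
           Path u (w ∷ xs) v

  -- IsDistance u v d says d(u,v) = d, with ⊤⁺ for ∞.
  data IsDistance (u v : Vertex) : ℕ ⁺ → Set where
    finite   : ∀ {xs} → Path u xs v →
               (∀ {ys} → Path u ys v → length xs ≤ length ys) →
               IsDistance u v [ length xs ]
    infinite : (∀ {xs} → ¬ Path u xs v) → IsDistance u v ⊤⁺

  -- A distance of the form [ k ] means that a path exists.
  data IsSignedDistance (u v : Vertex) : ℤ ⁺ → Set where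
    forward  : ∀ {k e} → IsDistance u v [ k ] → IsDistance v u e →
               [ k ] ≤⁺ e → IsSignedDistance u v [ + k ]
    backward : ∀ {k e} → IsDistance v u [ k ] → IsDistance u v e →
               [ k ] <⁺ e → IsSignedDistance u v [ ℤ.- (+ k) ]
    neither  : IsDistance u v ⊤⁺ → IsDistance v u ⊤⁺ →
               IsSignedDistance u v ⊤⁺

  IsDistanceVector : List Vertex → Vertex → List (ℤ ⁺) → Set
  IsDistanceVector S v = Pointwise (λ u d → IsSignedDistance u v d) S

  Resolving : List Vertex → Set
  Resolving S =
    ∀ {v w ds es} → v ≢ w →
    IsDistanceVector S v ds → IsDistanceVector S w es → ds ≢ es

  IsResolvingSet : List Vertex → Set
  IsResolvingSet S = Unique S × Resolving S

  HasMetricDimension : ℕ → Set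
  HasMetricDimension k =
    (∃[ S ] IsResolvingSet S × length S ≡ k) ×
    (∀ {S} → IsResolvingSet S → k ≤ length S)

-- A two-element multiset of heap sizes, represented by its sorted pair, so
-- that equality of multisets is propositional equality.
record Position : Set where
  constructor position
  field
    small  : ℕ
    large  : ℕ
    .small≤large : small ≤ large

⟅_,_⟆ : ℕ → ℕ → Position
⟅ a , b ⟆ = position (a ⊓ b) (a ⊔ b) (m⊓n≤m⊔n a b)

-- As ⟅ a , b ⟆ ≡ ⟅ b , a ⟆, the reduced heap a may be either one of p.
Move : Position → Position → Set
Move p q = ∃[ a ] ∃[ b ] ∃[ c ] p ≡ ⟅ a , b ⟆ × c < a × q ≡ ⟅ c , b ⟆

-- Reachability is an irrelevant component, so each reachable position is a
-- single vertex, however many sequences of moves lead to it.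
gameGraph : ℕ → Digraph
gameGraph n = record
  { Vertex = [ p ∈ Position ∣ Star Move ⟅ n , n ⟆ p ]
  ; Arc    = λ p q → Move (value p) (value q)
  }

{-# OPTIONS --safe #-}

-- An arc {a,x} → {c,x} with c < a is determined by x and the pair c < a, and
-- conversely, so there are (n + 1) · n(n + 1)/2 arcs.
--
-- A position p reaches q exactly when q ≤ p componentwise (heaps sorted), and
-- then d(p,q) is 0, 1 or 2: it is 1 when p ≠ q share a heap and 2 when they
-- share none.
--
-- Upper bound: d± from {s,s} to {a,b} tells how a and b compare with s.  Two
-- distinct numbers at most n are told apart by comparison with some odd number
-- s ≤ n, so the ⌈n/2⌉ positions {s,s} with s odd resolve the graph.
--
-- Lower bound: {i,i+1} and {i+1,i+1} are resolved by u only if i is a heap of u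
-- or u = {i+1,i+1}.  A given u does this for at most two values of i, and all
-- n values i < n are needed.
module Submission where

open import Defs
open import Data.Empty using (⊥; ⊥-elim)
open import Data.Fin.Properties using (toℕ<n; toℕ-injective; injective⇒≤)
open import Data.Integer as ℤ using (ℤ; +_)
open import Data.Irrelevant using ([_])
open import Data.List using
  (List; []; _∷_; _++_; length; map; upTo; applyUpTo; concatMap; cartesianProduct)
open import Data.List.Membership.Propositional using (_∈_)
open import Data.List.Membership.Propositional.Properties hiding (finite)
open import Data.List.Membership.Setoid.Properties using (index-injective)
open import Data.List.Properties using (length-applyUpTo; length-map; length-++; length-upTo)
open import Data.List.Relation.Binary.Pointwise using ([]; _∷_)
open import Data.List.Relation.Unary.All as All using (All; []; _∷_)
open import Data.List.Relation.Unary.All.Properties as All using (¬Any⇒All¬)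
open import Data.List.Relation.Unary.AllPairs using ([]; _∷_)
open import Data.List.Relation.Unary.Any as Any using (here; there; any?)
open import Data.List.Relation.Unary.Unique.Propositional using (Unique)
open import Data.List.Relation.Unary.Unique.Propositional.Properties
  using (++⁺; map⁺; upTo⁺; applyUpTo⁺₁; cartesianProduct⁺)
open import Data.Nat
open import Data.Nat.Properties
open import Data.List.Membership.DecPropositional _≟_ using (_∈?_)
open import Data.Nat.Solver using (module +-*-Solver)
open import Data.Product hiding (map)
open import Data.Refinement using (_,_; value)
open import Data.Sum using (_⊎_; inj₁; inj₂; [_,_]′)
open import Function using (_∘_; id; _⇔_; mk⇔; Equivalence)
open import Relation.Binary.Construct.Closure.ReflexiveTransitive using (Star; ε; _◅_; _◅◅_)
open import Relation.Binary.Construct.Add.Supremum.NonStrict _≤_ using ([_]; _≤⊤⁺)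
open import Relation.Binary.Construct.Add.Supremum.Strict _<_ using ([_]; [_]<⊤⁺)
open import Relation.Binary.PropositionalEquality
open import Relation.Nullary
open import Relation.Nullary.Decidable using (map′)
open import Relation.Nullary.Construct.Add.Supremum using (_⁺; ⊤⁺; [_])

open Equivalence using (to; from)
open Position using (small; large)

-- Counting with lists

-- Injectivity is asked only on members of `xs`: the maps counted with later, `vertex` and `arc`,
-- forget the order of the heaps and truncate them, so they are injective only on suitable lists.
image-cardinality : ∀ {A B : Set} {Q : B → Set} (f : A → B) xs → Unique xs →
  (∀ {x y} → x ∈ xs → y ∈ xs → f x ≡ f y → x ≡ y) →
  (∀ {x} → x ∈ xs → Q (f x)) →
  (∀ {y} → Q y → ∃[ x ] x ∈ xs × y ≡ f x) →
  HasCardinality Q (length xs)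
image-cardinality {A} {B} {Q} f xs xs! inj sound complete =
  map f xs , unique xs! inj , (λ y → mk⇔ image⇒Q Q⇒image) , length-map f xs
  where
  unique : ∀ {zs} → Unique zs →
           (∀ {x y} → x ∈ zs → y ∈ zs → f x ≡ f y → x ≡ y) → Unique (map f zs)
  unique []           _   = []
  unique (x∉ ∷ zs!) inj =
    All.map⁺ (All.tabulate λ y∈ eq → All.lookup x∉ y∈ (inj (here refl) (there y∈) eq))
    ∷ unique zs! (λ x∈ y∈ → inj (there x∈) (there y∈))

  image⇒Q : ∀ {y} → y ∈ map f xs → Q y
  image⇒Q y∈ with ∈-map⁻ f y∈
  ... | x , x∈ , refl = sound x∈

  Q⇒image : ∀ {y} → Q y → y ∈ map f xs
  Q⇒image q with complete q
  ... | x , x∈ , refl = ∈-map⁺ f x∈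

length-cartesianProduct : ∀ {A B : Set} (xs : List A) (ys : List B) →
  length (cartesianProduct xs ys) ≡ length xs * length ys
length-cartesianProduct []       ys = refl
length-cartesianProduct (x ∷ xs) ys = trans (length-++ (map (x ,_) ys))
  (cong₂ _+_ (length-map (x ,_) ys) (length-cartesianProduct xs ys))

-- Pigeonhole: sending each `i` to the index of its occurrence in `xs` is an injection between
-- finite sets.
covering⇒≤ : ∀ {n} xs → (∀ {i} → i < n → i ∈ xs) → n ≤ length xs
covering⇒≤ xs covered = injective⇒≤ {f = λ i → Any.index (covered (toℕ<n i))}
  λ {i} {j} eq → toℕ-injective
    (index-injective (setoid ℕ) (covered (toℕ<n i)) (covered (toℕ<n j)) eq)

-- The pairs with `c ≤ d` and `d < n`. They serve twice: at `suc n` as sorted positions, and at `n`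
-- as reductions of a heap from `suc d` to `c`.
wedge : ℕ → List (ℕ × ℕ)
wedge zero    = []
wedge (suc n) = map (_, n) (upTo (suc n)) ++ wedge n

∈-wedge⁻ : ∀ n {c d} → (c , d) ∈ wedge n → c ≤ d × d < n
∈-wedge⁻ (suc n) cd∈ with ∈-++⁻ (map (_, n) (upTo (suc n))) cd∈
... | inj₂ cd∈′ = map₂ m<n⇒m<1+n (∈-wedge⁻ n cd∈′)
... | inj₁ cd∈′ with ∈-map⁻ (_, n) cd∈′
... | _ , c∈ , refl = s≤s⁻¹ (∈-upTo⁻ c∈) , ≤-refl

∈-wedge⁺ : ∀ {n c d} → c ≤ d → d < n → (c , d) ∈ wedge n
∈-wedge⁺ {suc n} c≤d d<1+n with m≤n⇒m<n∨m≡n (s≤s⁻¹ d<1+n)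
... | inj₁ d<n  = ∈-++⁺ʳ (map (_, n) (upTo (suc n))) (∈-wedge⁺ c≤d d<n)
... | inj₂ refl = ∈-++⁺ˡ (∈-map⁺ (_, n) (∈-upTo⁺ (s≤s c≤d)))

wedge-unique : ∀ n → Unique (wedge n)
wedge-unique zero    = []
wedge-unique (suc n) =
  ++⁺ (map⁺ (cong proj₁) (upTo⁺ (suc n))) (wedge-unique n) disjoint
  where
  disjoint : ∀ {p} → ¬ (p ∈ map (_, n) (upTo (suc n)) × p ∈ wedge n)
  disjoint (p∈ , p∈′) with ∈-map⁻ (_, n) p∈
  ... | _ , _ , refl = <-irrefl refl (proj₂ (∈-wedge⁻ n p∈′))

2*length-wedge : ∀ n → 2 * length (wedge n) ≡ n * suc n
2*length-wedge zero    = refl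
2*length-wedge (suc n) = begin
  2 * length (wedge (suc n))
    ≡⟨ cong (2 *_) (length-++ (map (_, n) (upTo (suc n)))) ⟩
  2 * (length (map (_, n) (upTo (suc n))) + length (wedge n))
    ≡⟨ cong (λ k → 2 * (k + length (wedge n)))
         (trans (length-map (_, n) (upTo (suc n))) (length-upTo (suc n))) ⟩
  2 * (suc n + length (wedge n))
    ≡⟨ *-distribˡ-+ 2 (suc n) (length (wedge n)) ⟩
  2 * suc n + 2 * length (wedge n)
    ≡⟨ cong (λ k → 2 * suc n + k) (2*length-wedge n) ⟩
  2 * suc n + n * suc n
    ≡⟨ solve 1 (λ x → con 2 :* (con 1 :+ x) :+ x :* (con 1 :+ x)
                   := (con 1 :+ x) :* (con 2 :+ x)) refl n ⟩
  suc n * suc (suc n) ∎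
  where
  open ≡-Reasoning
  open +-*-Solver

-- Odd numbers and rounded halves

-- One of two consecutive numbers is odd. Hence some odd number lies weakly between any `x < y`.
odd-between : ∀ x → ∃[ t ] x ≤ suc (t + t) × suc (t + t) ≤ suc x
odd-between 0             = 0 , z≤n , ≤-refl
odd-between 1             = 0 , ≤-refl , s≤s z≤n
odd-between (suc (suc x)) with odd-between x
... | t , x≤ , ≤x = suc t
    , subst (suc (suc x) ≤_) (cong (suc ∘ suc) (sym (+-suc t t))) (s≤s (s≤s x≤))
    , subst (_≤ suc (suc (suc x))) (cong (suc ∘ suc) (sym (+-suc t t))) (s≤s (s≤s ≤x))

t<⌈n/2⌉⇒odd≤n : ∀ {t n} → t < ⌈ n /2⌉ → suc (t + t) ≤ n
t<⌈n/2⌉⇒odd≤n {t} {n} t< = s≤s⁻¹ (begin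
  suc (suc (t + t))               ≡⟨ cong suc (+-suc t t) ⟨
  -- `⌈ n /2⌉` unfolds to `⌊ suc n /2⌋`, which is at most `⌈ suc n /2⌉`; the two rounded halves of
  -- `suc n` then add up to it.
  suc t + suc t                   ≤⟨ +-mono-≤ t< (≤-trans t< (⌊n/2⌋≤⌈n/2⌉ (suc n))) ⟩
  ⌊ suc n /2⌋ + ⌈ suc n /2⌉       ≡⟨ ⌊n/2⌋+⌈n/2⌉≡n (suc n) ⟩
  suc n                           ∎)
  where open ≤-Reasoning

odd≤n⇒t<⌈n/2⌉ : ∀ {t n} → suc (t + t) ≤ n → t < ⌈ n /2⌉
odd≤n⇒t<⌈n/2⌉ {t} {n} odd≤n =
  -- `⌈ suc (t + t) /2⌉` computes to `suc ⌊ t + t /2⌋`.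
  subst (λ k → suc k ≤ ⌈ n /2⌉) (sym (n≡⌊n+n/2⌋ t)) (⌈n/2⌉-mono odd≤n)

-- Positions and moves

position-≡ : ∀ {p q} → small p ≡ small q → large p ≡ large q → p ≡ q
position-≡ {position _ _ _} {position _ _ _} refl refl = refl

sorted : ∀ p → small p ≤ large p
sorted (position a b a≤b) = recompute (a ≤? b) a≤b

⟅⟆-comm : ∀ a b → ⟅ a , b ⟆ ≡ ⟅ b , a ⟆
⟅⟆-comm a b = position-≡ (⊓-comm a b) (⊔-comm a b)

⟅⟆-sorted : ∀ {p a b} → a ≤ b → small p ≡ a → large p ≡ b → p ≡ ⟅ a , b ⟆
⟅⟆-sorted a≤b refl refl =
  position-≡ (sym (m≤n⇒m⊓n≡m a≤b)) (sym (m≤n⇒m⊔n≡n a≤b))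

⊓⊔-injective : ∀ a b c d → a ⊓ b ≡ c ⊓ d → a ⊔ b ≡ c ⊔ d →
               (a ≡ c × b ≡ d) ⊎ (a ≡ d × b ≡ c)
⊓⊔-injective a b c d s l with ≤-total a b | ≤-total c d
... | inj₁ p | inj₁ q
  rewrite m≤n⇒m⊓n≡m p | m≤n⇒m⊓n≡m q
        | m≤n⇒m⊔n≡n p | m≤n⇒m⊔n≡n q = inj₁ (s , l)
... | inj₁ p | inj₂ q
  rewrite m≤n⇒m⊓n≡m p | m≥n⇒m⊓n≡n q
        | m≤n⇒m⊔n≡n p | m≥n⇒m⊔n≡m q = inj₂ (s , l)
... | inj₂ p | inj₁ q
  rewrite m≥n⇒m⊓n≡n p | m≤n⇒m⊓n≡m q
        | m≥n⇒m⊔n≡m p | m≤n⇒m⊔n≡n q = inj₂ (l , s)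
... | inj₂ p | inj₂ q
  rewrite m≥n⇒m⊓n≡n p | m≥n⇒m⊓n≡n q
        | m≥n⇒m⊔n≡m p | m≥n⇒m⊔n≡m q = inj₁ (l , s)

⟅⟆-injective : ∀ a b c d → ⟅ a , b ⟆ ≡ ⟅ c , d ⟆ →
               (a ≡ c × b ≡ d) ⊎ (a ≡ d × b ≡ c)
⟅⟆-injective a b c d eq = ⊓⊔-injective a b c d (cong small eq) (cong large eq)

infix 4 _⊑_ _∈ʰ_ _∈ʰ?_ _⊑?_

-- On vertices this is reachability, the smaller position being reached from the larger: `path⇒⊑`
-- gives one direction, `distance₁` and `distance₂` the other for distinct vertices.
_⊑_ : Position → Position → Set
p ⊑ q = small p ≤ small q × large p ≤ large q

_⊑?_ : ∀ p q → Dec (p ⊑ q)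
p ⊑? q = (small p ≤? small q) ×-dec (large p ≤? large q)

⊑-refl : ∀ {p} → p ⊑ p
⊑-refl = ≤-refl , ≤-refl

⊑-trans : ∀ {p q r} → p ⊑ q → q ⊑ r → p ⊑ r
⊑-trans (a , b) (c , d) = ≤-trans a c , ≤-trans b d

⊑-antisym : ∀ {p q} → p ⊑ q → q ⊑ p → p ≡ q
⊑-antisym (a , b) (c , d) = position-≡ (≤-antisym a c) (≤-antisym b d)

_∈ʰ_ : ℕ → Position → Set
x ∈ʰ p = x ≡ small p ⊎ x ≡ large p

_∈ʰ?_ : ∀ x p → Dec (x ∈ʰ p)
x ∈ʰ? p = (x ≟ small p) ⊎-dec (x ≟ large p)

Share : Position → Position → Set
Share p q = ∃[ x ] x ∈ʰ p × x ∈ʰ q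

share? : ∀ p q → Dec (Share p q)
share? p q with small p ∈ʰ? q | large p ∈ʰ? q
... | yes s | _     = yes (_ , inj₁ refl , s)
... | no _  | yes l = yes (_ , inj₂ refl , l)
... | no ¬s | no ¬l = no λ { (_ , inj₁ refl , s) → ¬s s ; (_ , inj₂ refl , l) → ¬l l }

∈ʰ-⟅⟆ : ∀ a b → b ∈ʰ ⟅ a , b ⟆
∈ʰ-⟅⟆ a b with ≤-total a b
... | inj₁ a≤b = inj₂ (sym (m≤n⇒m⊔n≡n a≤b))
... | inj₂ b≤a = inj₁ (sym (m≥n⇒m⊓n≡n b≤a))

move⇒⊑ : ∀ {p q} → Move p q → q ⊑ p
move⇒⊑ (a , b , c , refl , c<a , refl) =
  ⊓-monoˡ-≤ b (<⇒≤ c<a) , ⊔-monoˡ-≤ b (<⇒≤ c<a)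

move⇒share : ∀ {p q} → Move p q → Share p q
move⇒share (a , b , c , refl , _ , refl) = b , ∈ʰ-⟅⟆ a b , ∈ʰ-⟅⟆ c b

move-irrefl : ∀ {p} → ¬ Move p p
move-irrefl (a , b , c , refl , c<a , eq) with ⟅⟆-injective a b c b eq
... | inj₁ (a≡c , _)   = <⇒≢ c<a (sym a≡c)
... | inj₂ (a≡b , b≡c) = <⇒≢ c<a (sym (trans a≡b b≡c))

-- The shared heap is kept and the other heap of `p` is reduced to the other heap of `q`. The four
-- cases record which heap of each position is the shared one.
share⇒move : ∀ {p q} → q ⊑ p → p ≢ q → Share p q → Move p q
share⇒move {p} {q} (s≤ , l≤) p≢q (x , x∈p , x∈q) = go x∈p x∈q
  where
  go : x ∈ʰ p → x ∈ʰ q → Move p q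
  go (inj₁ refl) (inj₁ eq) =
    large p , small p , large q
    , trans (⟅⟆-sorted (sorted p) refl refl) (⟅⟆-comm _ _)
    , ≤∧≢⇒< l≤ (λ l≡ → p≢q (position-≡ eq (sym l≡)))
    , trans (⟅⟆-sorted (subst (_≤ large q) (sym eq) (sorted q)) (sym eq) refl) (⟅⟆-comm _ _)
  go (inj₂ refl) (inj₂ eq) =
    small p , large p , small q
    , ⟅⟆-sorted (sorted p) refl refl
    , ≤∧≢⇒< s≤ (λ s≡ → p≢q (position-≡ (sym s≡) eq))
    , ⟅⟆-sorted (subst (small q ≤_) (sym eq) (sorted q)) refl (sym eq)
  -- The kept heap changes from the smaller to the larger one. If `small q` were `large p`, then
  -- `small q ≤ small p` would make all four heaps equal.
  go (inj₁ refl) (inj₂ eq) =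
    large p , small p , small q
    , trans (⟅⟆-sorted (sorted p) refl refl) (⟅⟆-comm _ _)
    , ≤∧≢⇒< (≤-trans s≤ (sorted p)) (λ s≡l → p≢q (position-≡
        (≤-antisym (≤-trans (sorted p) (≤-reflexive (sym s≡l))) s≤)
        (≤-antisym (≤-trans (≤-reflexive (sym s≡l)) (sorted q)) l≤)))
    , ⟅⟆-sorted (subst (small q ≤_) (sym eq) (sorted q)) refl (sym eq)
  -- Here `large p = small q ≤ small p` already makes all heaps equal.
  go (inj₂ refl) (inj₁ eq) = ⊥-elim (p≢q (position-≡
    (≤-antisym (≤-trans (sorted p) (≤-reflexive eq)) s≤)
    (≤-antisym (≤-trans (≤-reflexive eq) (sorted q)) l≤)))

-- Uniqueness of distances in any digraph

module _ {G : Digraph} where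

  distance-unique : ∀ {u v d e} → IsDistance G u v d → IsDistance G u v e → d ≡ e
  distance-unique (finite p p-min) (finite q q-min) =
    cong [_] (≤-antisym (p-min q) (q-min p))
  distance-unique (finite p _)   (infinite none) = ⊥-elim (none p)
  distance-unique (infinite none) (finite p _)   = ⊥-elim (none p)
  distance-unique (infinite _)   (infinite _)    = refl

  -- `forward` and `backward` exclude each other because they order the same two distances
  -- oppositely. Uniqueness lets a single computed value stand for every derivation of a signed
  -- distance.
  signed-unique : ∀ {u v d e} →
                  IsSignedDistance G u v d → IsSignedDistance G u v e → d ≡ e
  signed-unique (forward p _ _) (forward q _ _) with distance-unique p q
  ... | refl = refl
  signed-unique (backward p _ _) (backward q _ _) with distance-unique p q
  ... | refl = refl
  signed-unique (neither _ _) (neither _ _) = refl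
  signed-unique (forward p p′ le) (backward q q′ lt)
    with distance-unique p q′ | distance-unique p′ q
  signed-unique (forward p p′ [ le ]) (backward q q′ [ lt ])
    | refl | refl = ⊥-elim (<⇒≱ lt le)
  signed-unique (backward q q′ lt) (forward p p′ le)
    with distance-unique p q′ | distance-unique p′ q
  signed-unique (backward q q′ [ lt ]) (forward p p′ [ le ])
    | refl | refl = ⊥-elim (<⇒≱ lt le)
  signed-unique (forward p _ _) (neither q _) with () ← distance-unique p q
  signed-unique (neither q _) (forward p _ _) with () ← distance-unique p q
  signed-unique (backward p _ _) (neither _ q) with () ← distance-unique p q
  signed-unique (neither _ q) (backward p _ _) with () ← distance-unique p q

-- Vertices of the game graph

module _ (n : ℕ) where
  private
    G = gameGraph n
  open Digraph G

  vertex-≡ : {u v : Vertex} → value u ≡ value v → u ≡ v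
  vertex-≡ {_ , [ _ ]} {_ , [ _ ]} refl = refl

  ⊑-antisymᵛ : {u v : Vertex} → value u ⊑ value v → value v ⊑ value u → u ≡ v
  ⊑-antisymᵛ u⊑v v⊑u = vertex-≡ (⊑-antisym u⊑v v⊑u)

  reachable⇒large≤n : ∀ {p} → Star Move ⟅ n , n ⟆ p → large p ≤ n
  reachable⇒large≤n moves = ≤-trans (proj₂ (go moves)) (≤-reflexive (⊔-idem n))
    where
    go : ∀ {p q} → Star Move p q → q ⊑ p
    go {p} ε                   = ⊑-refl {p}
    go {p} {q} (_◅_ {j = r} m rest) = ⊑-trans {q} {r} {p} (go rest) (move⇒⊑ m)

  large≤n : (u : Vertex) → large (value u) ≤ n
  large≤n (p , [ r ]) = recompute (large p ≤? n) (reachable⇒large≤n r)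

  reduce : ∀ {a b c} → c ≤ a → Star Move ⟅ a , b ⟆ ⟅ c , b ⟆
  reduce c≤a with m≤n⇒m<n∨m≡n c≤a
  ... | inj₁ c<a  = (_ , _ , _ , refl , c<a , refl) ◅ ε
  ... | inj₂ refl = ε

  reachable : ∀ {a b} → a ≤ n → b ≤ n → Star Move ⟅ n , n ⟆ ⟅ a , b ⟆
  reachable {a} {b} a≤n b≤n =
    reduce b≤n ◅◅ subst (λ p → Star Move p ⟅ a , b ⟆) (⟅⟆-comm n b) (reduce a≤n)

  -- Truncating at n makes this total; wherever it matters, a and b are at most n.
  vertex : ℕ → ℕ → Vertex
  vertex a b = ⟅ a ⊓ n , b ⊓ n ⟆ , [ reachable (m⊓n≤n a n) (m⊓n≤n b n) ]

  vertex-value : ∀ {a b} → a ≤ n → b ≤ n → value (vertex a b) ≡ ⟅ a , b ⟆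
  vertex-value a≤n b≤n rewrite m≤n⇒m⊓n≡m a≤n | m≤n⇒m⊓n≡m b≤n = refl

  vertex-small : ∀ {a b} → a ≤ b → b ≤ n → small (value (vertex a b)) ≡ a
  vertex-small a≤b b≤n =
    trans (cong small (vertex-value (≤-trans a≤b b≤n) b≤n)) (m≤n⇒m⊓n≡m a≤b)

  vertex-large : ∀ {a b} → a ≤ b → b ≤ n → large (value (vertex a b)) ≡ b
  vertex-large a≤b b≤n =
    trans (cong large (vertex-value (≤-trans a≤b b≤n) b≤n)) (m≤n⇒m⊔n≡n a≤b)

  vertex-η : ∀ u → vertex (small (value u)) (large (value u)) ≡ u
  vertex-η u = vertex-≡ (position-≡
    (vertex-small (sorted (value u)) (large≤n u))
    (vertex-large (sorted (value u)) (large≤n u)))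

  -- Signed distances in the game graph

  path⇒⊑ : ∀ {u v xs} → Path G u xs v → value v ⊑ value u
  path⇒⊑ {u} nil = ⊑-refl {value u}
  path⇒⊑ {u} {v} (cons {w = w} m _ p) =
    ⊑-trans {value v} {value w} {value u} (path⇒⊑ p) (move⇒⊑ m)

  -- The signed distance read off from `⊑` and `Share`, without paths. The name places `v` relative
  -- to `u`, and the subscript is the number of moves.
  data Signed (u v : Vertex) : ℤ ⁺ → Set where
    equal  : u ≡ v → Signed u v [ + 0 ]
    below₁ : value v ⊑ value u → u ≢ v → Share (value u) (value v) →
             Signed u v [ + 1 ]
    below₂ : value v ⊑ value u → ¬ Share (value u) (value v) →
             Signed u v [ + 2 ]
    above₁ : value u ⊑ value v → u ≢ v → Share (value u) (value v) →
             Signed u v [ ℤ.- (+ 1) ]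
    above₂ : value u ⊑ value v → ¬ Share (value u) (value v) →
             Signed u v [ ℤ.- (+ 2) ]
    incomparable : ¬ value u ⊑ value v → ¬ value v ⊑ value u → Signed u v ⊤⁺

  _≟ᵛ_ : (u v : Vertex) → Dec (u ≡ v)
  u ≟ᵛ v = map′ vertex-≡ (cong value) (map′
    (λ (s , l) → position-≡ s l) (λ eq → cong small eq , cong large eq)
    ((small (value u) ≟ small (value v)) ×-dec (large (value u) ≟ large (value v))))

  share-refl : ∀ {u v : Vertex} → u ≡ v → Share (value u) (value v)
  share-refl refl = _ , inj₁ refl , inj₁ refl

  share-sym : ∀ {p q} → Share p q → Share q p
  share-sym (x , x∈p , x∈q) = x , x∈q , x∈p

  signed : ∀ u v → ∃ (Signed u v)
  signed u v with u ≟ᵛ v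
  ... | yes eq = _ , equal eq
  ... | no u≢v with value v ⊑? value u | value u ⊑? value v | share? (value u) (value v)
  ... | yes v⊑u | _       | yes sh = _ , below₁ v⊑u u≢v sh
  ... | yes v⊑u | _       | no ¬sh = _ , below₂ v⊑u ¬sh
  ... | no _    | yes u⊑v | yes sh = _ , above₁ u⊑v u≢v sh
  ... | no _    | yes u⊑v | no ¬sh = _ , above₂ u⊑v ¬sh
  ... | no ¬v⊑u | no ¬u⊑v | _      = _ , incomparable ¬u⊑v ¬v⊑u

  arc-≢ : ∀ {u v} → Arc u v → u ≢ v
  arc-≢ move refl = move-irrefl move

  no-path : ∀ {u v} → ¬ value v ⊑ value u → IsDistance G u v ⊤⁺
  no-path ¬v⊑u = infinite (¬v⊑u ∘ path⇒⊑)

  distance₁ : ∀ {u v} → value v ⊑ value u → u ≢ v → Share (value u) (value v) →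
              IsDistance G u v [ 1 ]
  distance₁ {u} {v} v⊑u u≢v sh = finite
    (cons (share⇒move v⊑u (u≢v ∘ vertex-≡) sh) (λ { (here eq) → u≢v eq }) nil)
    shortest
    where
    shortest : ∀ {ys} → Path G u ys v → 1 ≤ length ys
    shortest nil          = ⊥-elim (u≢v refl)
    shortest (cons _ _ _) = s≤s z≤n

  -- Two moves suffice, one for each heap. A single move would keep a heap, which both positions
  -- would then share.
  distance₂ : ∀ {u v} → value v ⊑ value u → ¬ Share (value u) (value v) →
              IsDistance G u v [ 2 ]
  distance₂ {u} {v} (s≤ , l≤) ¬sh = finite path shortest
    where
    a = small (value u)
    b = large (value u)
    c = small (value v)
    d = large (value v)

    c≤b : c ≤ b
    c≤b = ≤-trans (sorted (value v)) l≤

    m : Vertex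
    -- Halfway, the smaller heap is already that of `v` and the larger heap is still that of `u`.
    m = vertex c b

    m-value : value m ≡ ⟅ c , b ⟆
    m-value = vertex-value (≤-trans c≤b (large≤n u)) (large≤n u)

    u→m : Move (value u) (value m)
    u→m = a , b , c , ⟅⟆-sorted (sorted (value u)) refl refl
        , ≤∧≢⇒< s≤ (λ c≡a → ¬sh (a , inj₁ refl , inj₁ (sym c≡a))) , m-value

    m→v : Move (value m) (value v)
    m→v = b , c , d , trans m-value (⟅⟆-comm c b)
        , ≤∧≢⇒< l≤ (λ d≡b → ¬sh (b , inj₂ refl , inj₂ (sym d≡b)))
        , trans (⟅⟆-sorted (sorted (value v)) refl refl) (⟅⟆-comm c d)

    path : Path G u (m ∷ v ∷ []) v
    path = cons u→m
      (λ { (here u≡m)           → arc-≢ u→m u≡m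
         ; (there (here refl)) → ¬sh (share-refl {u} {u} refl) })
      (cons m→v (λ { (here m≡v) → arc-≢ m→v m≡v }) nil)

    shortest : ∀ {ys} → Path G u ys v → 2 ≤ length ys
    shortest nil                       = ⊥-elim (¬sh (share-refl {u} {u} refl))
    shortest (cons move _ nil)         = ⊥-elim (¬sh (move⇒share move))
    shortest (cons _ _ (cons _ _ _))   = s≤s (s≤s z≤n)

  ⊑-strict : ∀ {u v} → value v ⊑ value u → u ≢ v → ¬ value u ⊑ value v
  ⊑-strict v⊑u u≢v u⊑v = u≢v (⊑-antisymᵛ u⊑v v⊑u)

  unshared⇒≢ : ∀ {u v} → ¬ Share (value u) (value v) → u ≢ v
  unshared⇒≢ {u} ¬sh refl = ¬sh (share-refl {u} {u} refl)

  -- Since `⊑` is antisymmetric, distinct vertices are joined by paths in at most one direction; the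
  -- opposite distance is infinite and the sign is settled.
  Signed⇒IsSignedDistance : ∀ {u v d} → Signed u v d → IsSignedDistance G u v d
  Signed⇒IsSignedDistance (equal refl) =
    forward (finite nil (λ _ → z≤n)) (finite nil (λ _ → z≤n)) [ z≤n ]
  Signed⇒IsSignedDistance (below₁ v⊑u u≢v sh) =
    forward (distance₁ v⊑u u≢v sh) (no-path (⊑-strict v⊑u u≢v)) (_ ≤⊤⁺)
  Signed⇒IsSignedDistance {u} {v} (below₂ v⊑u ¬sh) =
    forward (distance₂ {u} {v} v⊑u ¬sh)
      (no-path (⊑-strict {u} {v} v⊑u (unshared⇒≢ ¬sh))) (_ ≤⊤⁺)
  Signed⇒IsSignedDistance {u} {v} (above₁ u⊑v u≢v sh) =
    backward (distance₁ u⊑v (u≢v ∘ sym) (share-sym {value u} {value v} sh))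
      (no-path (⊑-strict u⊑v (u≢v ∘ sym))) [ _ ]<⊤⁺
  Signed⇒IsSignedDistance {u} {v} (above₂ u⊑v ¬sh) =
    backward (distance₂ {v} {u} u⊑v (¬sh ∘ share-sym {value v} {value u}))
      (no-path (⊑-strict {v} {u} u⊑v (unshared⇒≢ ¬sh ∘ sym))) [ _ ]<⊤⁺
  Signed⇒IsSignedDistance (incomparable ¬u⊑v ¬v⊑u) = neither (no-path ¬v⊑u) (no-path ¬u⊑v)

  -- `signed` classifies every pair, and by uniqueness the value it finds is the given one.
  IsSignedDistance⇒Signed : ∀ {u v d} → IsSignedDistance G u v d → Signed u v d
  IsSignedDistance⇒Signed {u} {v} dist with signed u v
  ... | _ , sg with signed-unique {G} dist (Signed⇒IsSignedDistance sg)
  ... | refl = sg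

  -- Order and size

  order : HasOrder G (length (wedge (suc n)))
  order = image-cardinality (λ (c , d) → vertex c d) (wedge (suc n)) (wedge-unique (suc n))
    injective (λ _ → _)
    (λ {u} _ → _ , ∈-wedge⁺ (sorted (value u)) (s≤s (large≤n u)) , sym (vertex-η u))
    where
    injective : ∀ {p q} → p ∈ wedge (suc n) → q ∈ wedge (suc n) →
                uncurry vertex p ≡ uncurry vertex q → p ≡ q
    injective p∈ q∈ eq with ∈-wedge⁻ (suc n) p∈ | ∈-wedge⁻ (suc n) q∈
    ... | c≤d , s≤s d≤n | c′≤d′ , s≤s d′≤n = cong₂ _,_
      (trans (sym (vertex-small c≤d d≤n))
        (trans (cong (small ∘ value) eq) (vertex-small c′≤d′ d′≤n)))
      (trans (sym (vertex-large c≤d d≤n))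
        (trans (cong (large ∘ value) eq) (vertex-large c′≤d′ d′≤n)))

  -- The triple (b , c , d) stands for the arc from ⟅ suc d , b ⟆ to ⟅ c , b ⟆.
  triples : List (ℕ × ℕ × ℕ)
  triples = cartesianProduct (upTo (suc n)) (wedge n)

  arc : ℕ × ℕ × ℕ → Vertex × Vertex
  arc (b , c , d) = vertex (suc d) b , vertex c b

  ∈-triples⁻ : ∀ {b c d} → (b , c , d) ∈ triples → b ≤ n × c ≤ d × d < n
  ∈-triples⁻ t∈ with ∈-cartesianProduct⁻ (upTo (suc n)) (wedge n) t∈
  ... | b∈ , cd∈ = s≤s⁻¹ (∈-upTo⁻ b∈) , ∈-wedge⁻ n cd∈

  size : HasSize G (length triples)
  size = image-cardinality arc triples
    (cartesianProduct⁺ (upTo⁺ (suc n)) (wedge-unique n)) injective sound complete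
    where
    injective : ∀ {s t} → s ∈ triples → t ∈ triples → arc s ≡ arc t → s ≡ t
    injective {b , c , d} {b′ , c′ , d′} s∈ t∈ eq
      with ∈-triples⁻ s∈ | ∈-triples⁻ t∈
    ... | b≤n , c≤d , d<n | b′≤n , c′≤d′ , d′<n
      with ⟅⟆-injective (suc d) b (suc d′) b′
             (trans (sym (vertex-value d<n b≤n))
               (trans (cong (value ∘ proj₁) eq) (vertex-value d′<n b′≤n)))
         | ⟅⟆-injective c b c′ b′
             (trans (sym (vertex-value (≤-trans c≤d (<⇒≤ d<n)) b≤n))
               (trans (cong (value ∘ proj₂) eq)
                 (vertex-value (≤-trans c′≤d′ (<⇒≤ d′<n)) b′≤n)))
    ... | inj₁ (refl , refl) | inj₁ (refl , _)    = refl
    ... | inj₁ (refl , refl) | inj₂ (refl , refl) = refl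
    ... | inj₂ (refl , refl) | inj₁ (refl , refl) = refl
    -- If the heaps match crosswise at both ends, then `c = b′ = suc d`, against `c ≤ d`. In the
    -- mixed cases the coincidences force equal triples.
    ... | inj₂ (refl , _)    | inj₂ (refl , _)    = ⊥-elim (<-irrefl refl c≤d)

    sound : ∀ {t} → t ∈ triples → uncurry Arc (arc t)
    sound {b , c , d} t∈ with ∈-triples⁻ t∈
    ... | b≤n , c≤d , d<n =
      suc d , b , c , vertex-value d<n b≤n , s≤s c≤d
      , vertex-value (≤-trans c≤d (<⇒≤ d<n)) b≤n

    complete : ∀ {uv} → uncurry Arc uv → ∃[ t ] t ∈ triples × uv ≡ arc t
    complete {u , v} (suc d , b , c , u≡ , s≤s c≤d , v≡) =
      (b , c , d)
      , ∈-cartesianProduct⁺ (∈-upTo⁺ (s≤s b≤n)) (∈-wedge⁺ c≤d d<n)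
      , cong₂ _,_
          (vertex-≡ (trans u≡ (sym (vertex-value d<n b≤n))))
          (vertex-≡ (trans v≡ (sym (vertex-value (≤-trans c≤d (<⇒≤ d<n)) b≤n))))
      where
      heaps≤n : suc d ⊔ b ≤ n
      heaps≤n = subst (_≤ n) (cong large u≡) (large≤n u)

      d<n : d < n
      d<n = ≤-trans (m≤m⊔n (suc d) b) heaps≤n

      b≤n : b ≤ n
      b≤n = ≤-trans (m≤n⊔m (suc d) b) heaps≤n

  2*order : 2 * length (wedge (suc n)) ≡ n ^ 2 + 3 * n + 2
  2*order = trans (2*length-wedge (suc n))
    (solve 1 (λ x → (con 1 :+ x) :* (con 2 :+ x) := x :^ 2 :+ con 3 :* x :+ con 2) refl n)
    where open +-*-Solver

  2*size : 2 * length triples ≡ n * (n + 1) ^ 2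
  2*size = begin
    2 * length triples
      ≡⟨ cong (2 *_) (trans (length-cartesianProduct (upTo (suc n)) (wedge n))
           (cong (_* length (wedge n)) (length-upTo (suc n)))) ⟩
    2 * (suc n * length (wedge n))
      ≡⟨ solve 2 (λ x w → con 2 :* ((con 1 :+ x) :* w) := (con 1 :+ x) :* (con 2 :* w))
           refl n (length (wedge n)) ⟩
    suc n * (2 * length (wedge n))
      ≡⟨ cong (suc n *_) (2*length-wedge n) ⟩
    suc n * (n * suc n)
      ≡⟨ solve 1 (λ x → (con 1 :+ x) :* (x :* (con 1 :+ x)) := x :* (x :+ con 1) :^ 2) refl n ⟩
    n * (n + 1) ^ 2 ∎
    where
    open ≡-Reasoning
    open +-*-Solver

  -- Lower bound on the metric dimension

  -- `u` does not resolve `v` and `w`. Both bounds are argued through this, one landmark at a time.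
  Common : Vertex → Vertex → Vertex → Set
  Common v w u = ∃[ d ] IsSignedDistance G u v d × IsSignedDistance G u w d

  common-vector : ∀ {v w S} → All (Common v w) S →
                  ∃[ ds ] IsDistanceVector G S v ds × IsDistanceVector G S w ds
  common-vector []                      = [] , [] , []
  common-vector ((d , dv , dw) ∷ rest) with common-vector rest
  ... | ds , dvs , dws = d ∷ ds , dv ∷ dvs , dw ∷ dws

  -- The values i for which u may resolve the pair ⟅ i , suc i ⟆, ⟅ suc i , suc i ⟆.
  covered : Vertex → List ℕ
  covered u with small (value u) ≟ large (value u)
  ... | yes _ = small (value u) ∷ pred (large (value u)) ∷ []
  ... | no  _ = small (value u) ∷ large (value u) ∷ []

  -- At the position with both heaps empty, `pred` returns 0 and the list repeats 0, so the length
  -- is still 2.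
  length-covered : ∀ u → length (covered u) ≡ 2
  length-covered u with small (value u) ≟ large (value u)
  ... | yes _ = refl
  ... | no  _ = refl

  heap⇒covered : ∀ {i u} → i ∈ʰ value u → i ∈ covered u
  heap⇒covered {u = u} i∈u with small (value u) ≟ large (value u) | i∈u
  ... | yes _   | inj₁ i≡s = here i≡s
  ... | yes s≡l | inj₂ i≡l = here (trans i≡l (sym s≡l))
  ... | no _    | inj₁ i≡s = here i≡s
  ... | no _    | inj₂ i≡l = there (here i≡l)

  -- The entry `pred (large (value u))` exists for this case: `u` is itself a member of the pair for
  -- `i`, although `i` is not one of its heaps.
  diagonal⇒covered : ∀ {i u} → small (value u) ≡ suc i → large (value u) ≡ suc i → i ∈ covered u
  diagonal⇒covered {u = u} s≡ l≡ with small (value u) ≟ large (value u)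
  ... | yes _   = there (here (sym (cong pred l≡)))
  ... | no  s≢l = ⊥-elim (s≢l (trans s≡ (sym l≡)))

  -- Away from equality, `Signed` depends only on the two comparisons with `u` and on sharing a heap
  -- with `u`.
  signed-transfer : ∀ {u v w d} →
    (value u ⊑ value v ⇔ value u ⊑ value w) →
    (value v ⊑ value u ⇔ value w ⊑ value u) →
    (Share (value u) (value v) ⇔ Share (value u) (value w)) →
    u ≢ v → u ≢ w → Signed u v d → Signed u w d
  signed-transfer up down sh u≢v u≢w (equal u≡v)            = ⊥-elim (u≢v u≡v)
  signed-transfer up down sh u≢v u≢w (below₁ v⊑u _ s)       = below₁ (to down v⊑u) u≢w (to sh s)
  signed-transfer up down sh u≢v u≢w (below₂ v⊑u ¬s)        = below₂ (to down v⊑u) (¬s ∘ from sh)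
  signed-transfer up down sh u≢v u≢w (above₁ u⊑v _ s)       = above₁ (to up u⊑v) u≢w (to sh s)
  signed-transfer up down sh u≢v u≢w (above₂ u⊑v ¬s)        = above₂ (to up u⊑v) (¬s ∘ from sh)
  signed-transfer up down sh u≢v u≢w (incomparable ¬up ¬dn) =
    incomparable (¬up ∘ from up) (¬dn ∘ from down)

  -- The pair differs only in the smaller heap, `i` against `suc i`. The equivalence `up` could fail
  -- only at `u = w`, while `down` and `share` could fail only if `i` is a heap of `u`; in each case
  -- `i` is covered.
  uncovered⇒common : ∀ {i u v w} →
    small (value v) ≡ i → large (value v) ≡ suc i →
    small (value w) ≡ suc i → large (value w) ≡ suc i →
    ¬ i ∈ covered u → Common v w u
  uncovered⇒common {i} {u} {v} {w} refl lv sw lw i∉ with signed u v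
  ... | d , sg = d , Signed⇒IsSignedDistance sg
               , Signed⇒IsSignedDistance (signed-transfer up down share u≢v u≢w sg)
    where
    i∉u : ¬ i ∈ʰ value u
    i∉u = i∉ ∘ heap⇒covered

    u≢v : u ≢ v
    u≢v refl = i∉u (inj₁ refl)

    u≢w : u ≢ w
    u≢w refl = i∉ (diagonal⇒covered sw lw)

    up : value u ⊑ value v ⇔ value u ⊑ value w
    up = mk⇔
      (λ (s , l) → ≤-trans s (≤-trans (n≤1+n i) (≤-reflexive (sym sw)))
                 , ≤-trans l (≤-reflexive (trans lv (sym lw))))
      (λ (s , l) → below s l , ≤-trans l (≤-reflexive (trans lw (sym lv))))
      where
      below : small (value u) ≤ small (value w) → large (value u) ≤ large (value w) →
              small (value u) ≤ i
      below s l with m≤n⇒m<n∨m≡n s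
      ... | inj₁ s< = s≤s⁻¹ (≤-trans s< (≤-reflexive sw))
      -- With `small (value u)` equal to `suc i` and `large (value u)` at most `suc i`, `u` would be
      -- `w`.
      ... | inj₂ s≡ = ⊥-elim (u≢w (vertex-≡ (position-≡ s≡ (≤-antisym l
              (≤-trans (≤-reflexive (trans lw (trans (sym sw) (sym s≡)))) (sorted (value u)))))))

    down : value v ⊑ value u ⇔ value w ⊑ value u
    down = mk⇔
      (λ (s , l) → ≤-trans (≤-reflexive sw) (≤∧≢⇒< s (i∉u ∘ inj₁))
                 , ≤-trans (≤-reflexive (trans lw (sym lv))) l)
      (λ (s , l) → ≤-trans (n≤1+n i) (≤-trans (≤-reflexive (sym sw)) s)
                 , ≤-trans (≤-reflexive (trans lv (sym lw))) l)

    share : Share (value u) (value v) ⇔ Share (value u) (value w)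
    share = mk⇔
      (λ { (x , x∈u , inj₁ refl) → ⊥-elim (i∉u x∈u)
         ; (x , x∈u , inj₂ x≡)   → x , x∈u , inj₂ (trans x≡ (trans lv (sym lw))) })
      (λ { (x , x∈u , inj₁ x≡)   → x , x∈u , inj₂ (trans x≡ (trans sw (sym lv)))
         ; (x , x∈u , inj₂ x≡)   → x , x∈u , inj₂ (trans x≡ (trans lw (sym lv))) })

  resolving⇒covering : ∀ {S} → Resolving G S → ∀ {i} → i < n → i ∈ concatMap covered S
  resolving⇒covering {S} resolving {i} i<n with any? (λ u → i ∈? covered u) S
  ... | yes i∈ = ∈-concatMap⁺ covered i∈
  ... | no  i∉ with common-vector (All.map
    (uncovered⇒common
      (vertex-small (n≤1+n i) i<n) (vertex-large (n≤1+n i) i<n)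
      (vertex-small (≤-refl {suc i}) i<n) (vertex-large (≤-refl {suc i}) i<n))
    (¬Any⇒All¬ S i∉))
  ... | _ , dvs , dws = ⊥-elim (resolving v≢w dvs dws refl)
    where
    v≢w : vertex i (suc i) ≢ vertex (suc i) (suc i)
    v≢w eq = 1+n≢n (trans (sym (vertex-small (≤-refl {suc i}) i<n))
      (trans (cong (small ∘ value) (sym eq)) (vertex-small (n≤1+n i) i<n)))

  length-concatMap-covered : ∀ S → length (concatMap covered S) ≡ length S + length S
  length-concatMap-covered []      = refl
  length-concatMap-covered (u ∷ S) = begin
    length (covered u ++ concatMap covered S)        ≡⟨ length-++ (covered u) ⟩
    length (covered u) + length (concatMap covered S)
      ≡⟨ cong₂ _+_ (length-covered u) (length-concatMap-covered S) ⟩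
    suc (suc (length S + length S))                  ≡⟨ cong suc (+-suc (length S) (length S)) ⟨
    suc (length S + suc (length S))                  ∎
    where open ≡-Reasoning

  -- All `n` values occur in a list of length twice that of `S`; taking rounded halves of both
  -- lengths gives the bound.
  dimension-lower : ∀ {S} → Resolving G S → ⌈ n /2⌉ ≤ length S
  dimension-lower {S} resolving = begin
    ⌈ n /2⌉                   ≤⟨ ⌈n/2⌉-mono (covering⇒≤ _ (resolving⇒covering resolving)) ⟩
    ⌈ length (concatMap covered S) /2⌉ ≡⟨ cong ⌈_/2⌉ (length-concatMap-covered S) ⟩
    ⌈ length S + length S /2⌉ ≡⟨ n≡⌈n+n/2⌉ (length S) ⟨
    length S                  ∎
    where open ≤-Reasoning

  -- Upper bound on the metric dimension

  diagonal : ℕ → Vertex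
  diagonal t = vertex (suc (t + t)) (suc (t + t))

  landmarks : List Vertex
  landmarks = applyUpTo diagonal ⌈ n /2⌉

  landmarks-unique : Unique landmarks
  landmarks-unique = applyUpTo⁺₁ diagonal ⌈ n /2⌉ λ {i} {j} i<j j< eq →
    <⇒≢ (s≤s (+-mono-< i<j i<j)) (trans
      (sym (vertex-small ≤-refl (t<⌈n/2⌉⇒odd≤n (<-trans i<j j<))))
      (trans (cong (small ∘ value) eq) (vertex-small ≤-refl (t<⌈n/2⌉⇒odd≤n j<))))

  common-member : ∀ {v w S ds} → IsDistanceVector G S v ds → IsDistanceVector G S w ds →
                  ∀ {u} → u ∈ S → Common v w u
  common-member (dv ∷ _)   (dw ∷ _)   (here refl) = _ , dv , dw
  common-member (_ ∷ dvs)  (_ ∷ dws)  (there u∈)  = common-member dvs dws u∈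

  module _ {u v w d} (diag : small (value u) ≡ large (value u))
           (sv : Signed u v d) (sw : Signed u w d) where

    -- Let `s` be the heap size of the diagonal `u`. Then `u ⊑ w`, so the common value is 0, -1 or
    -- -2. At 0 all three vertices agree. At -1 the heap `s` lies in `w`, so
    -- `small (value w) ≤ s ≤ small (value v)`. At -2, `u ⊑ v` gives `small (value v) = s`, a shared
    -- heap.
    separate-small : small (value v) ≤ small (value u) → small (value u) ≤ small (value w) →
                     ¬ small (value v) < small (value w)
    separate-small v≤u u≤w v<w = go sv sw
      where
      u⊑w : value u ⊑ value w
      u⊑w = u≤w , ≤-trans (≤-reflexive (sym diag)) (≤-trans u≤w (sorted (value w)))

      go : Signed u v d → Signed u w d → ⊥
      go (equal refl)       (equal refl)         = <-irrefl refl v<w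
      go (below₁ _ _ _)     (below₁ w⊑u u≢w _)   = u≢w (⊑-antisymᵛ u⊑w w⊑u)
      go (below₂ _ _)       (below₂ w⊑u ¬sh)     = ¬sh (share-refl {u} {w} (⊑-antisymᵛ u⊑w w⊑u))
      go (above₁ (u≤v , _) _ _) (above₁ _ _ (x , x∈u , x∈w)) = <-irrefl refl (begin-strict
        x                ≡⟨ [ id , (λ x≡l → trans x≡l (sym diag)) ]′ x∈u ⟩
        small (value u)  ≤⟨ u≤v ⟩
        small (value v)  <⟨ v<w ⟩
        small (value w)  ≤⟨ [ ≤-reflexive ∘ sym
                            , (λ x≡l → ≤-trans (sorted (value w)) (≤-reflexive (sym x≡l))) ]′ x∈w ⟩
        x                ∎)
        where open ≤-Reasoning
      go (above₂ (u≤v , _) ¬sh) _                = ¬sh (_ , inj₁ refl , inj₁ (≤-antisym u≤v v≤u))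
      go (incomparable _ _) (incomparable ¬u⊑w _) = ¬u⊑w u⊑w

    -- The dual argument: now `v ⊑ u`, so the common value is 0, 1 or 2. At 1 the shared heap bounds
    -- `large (value v)` from below by that of `w`; at 2 it is `w` that shares its larger heap with
    -- `u`.
    separate-large : large (value v) ≤ large (value u) → large (value u) ≤ large (value w) →
                     ¬ large (value v) < large (value w)
    separate-large v≤u u≤w v<w = go sv sw
      where
      v⊑u : value v ⊑ value u
      v⊑u = ≤-trans (sorted (value v)) (≤-trans v≤u (≤-reflexive (sym diag))) , v≤u

      go : Signed u v d → Signed u w d → ⊥
      go (equal refl)       (equal refl)         = <-irrefl refl v<w
      go (above₁ u⊑v u≢v _) _                    = u≢v (⊑-antisymᵛ u⊑v v⊑u)
      go (above₂ u⊑v ¬sh)   _                    = ¬sh (share-refl {u} {v} (⊑-antisymᵛ u⊑v v⊑u))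
      go (below₁ _ _ (x , x∈u , x∈v)) (below₁ (_ , w≤u) _ _) = <-irrefl refl (begin-strict
        x                ≤⟨ [ (λ x≡s → ≤-trans (≤-reflexive x≡s) (sorted (value v)))
                            , ≤-reflexive ]′ x∈v ⟩
        large (value v)  <⟨ v<w ⟩
        large (value w)  ≤⟨ w≤u ⟩
        large (value u)  ≡⟨ [ (λ x≡s → trans x≡s diag) , id ]′ x∈u ⟨
        x                ∎)
        where open ≤-Reasoning
      go (below₂ _ _) (below₂ (_ , w≤u) ¬sh)     = ¬sh (_ , inj₂ refl , inj₂ (≤-antisym u≤w w≤u))
      go (incomparable _ ¬v⊑u) _                 = ¬v⊑u v⊑u

  -- The odd number `s` may coincide with `x` or `y`, which is why the separation arguments assume
  -- only weak inequalities around the landmark.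
  landmark-between : ∀ {x y} → x < y → y ≤ n →
    ∃[ s ] ∃[ u ] u ∈ landmarks × small (value u) ≡ s × large (value u) ≡ s × x ≤ s × s ≤ y
  landmark-between {x} x<y y≤n with odd-between x
  ... | t , x≤s , s≤1+x =
    suc (t + t) , diagonal t , ∈-applyUpTo⁺ diagonal (odd≤n⇒t<⌈n/2⌉ {t} s≤n)
    , vertex-small ≤-refl s≤n , vertex-large ≤-refl s≤n , x≤s , s≤y
    where
    s≤y = ≤-trans s≤1+x x<y
    s≤n = ≤-trans s≤y y≤n

  module _ {v w ds} (dvs : IsDistanceVector G landmarks v ds)
           (dws : IsDistanceVector G landmarks w ds) where

    small-≮ : ¬ small (value v) < small (value w)
    small-≮ v<w with landmark-between v<w (≤-trans (sorted (value w)) (large≤n w))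
    ... | _ , u , u∈ , refl , l≡s , v≤s , s≤w with common-member dvs dws u∈
    ... | _ , dv , dw = separate-small (sym l≡s)
      (IsSignedDistance⇒Signed dv) (IsSignedDistance⇒Signed dw) v≤s s≤w v<w

    large-≮ : ¬ large (value v) < large (value w)
    large-≮ v<w with landmark-between v<w (large≤n w)
    ... | _ , u , u∈ , s≡l , refl , v≤l , l≤w with common-member dvs dws u∈
    ... | _ , dv , dw = separate-large s≡l
      (IsSignedDistance⇒Signed dv) (IsSignedDistance⇒Signed dw) v≤l l≤w v<w

  landmarks-resolving : Resolving G landmarks
  -- Equal vectors rule out strict inequality in either direction, for the smaller heaps and for the
  -- larger ones.
  landmarks-resolving v≢w dvs dws refl = v≢w (vertex-≡ (position-≡
    (≤-antisym (≮⇒≥ (small-≮ dws dvs)) (≮⇒≥ (small-≮ dvs dws)))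
    (≤-antisym (≮⇒≥ (large-≮ dws dvs)) (≮⇒≥ (large-≮ dvs dws)))))

  dimension : HasMetricDimension G ⌈ n /2⌉
  dimension =
    (landmarks , (landmarks-unique , landmarks-resolving) , length-applyUpTo diagonal ⌈ n /2⌉)
    , dimension-lower ∘ proj₂

theorem3p2 : ∀ (n : ℕ) → 0 < n →
    (∃[ v ] HasOrder (gameGraph n) v × 2 * v ≡ n ^ 2 + 3 * n + 2) ×
    (∃[ e ] HasSize (gameGraph n) e × 2 * e ≡ n * (n + 1) ^ 2) ×
    HasMetricDimension (gameGraph n) ⌈ n /2⌉
theorem3p2 n _ = (_ , order n , 2*order n) , (_ , size n , 2*size n) , dimension n
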